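{- For any integer $\gamma \geq 0$, the partial composition of $\mathsf{Dias}_\gamma$ over the $\mathsf{K}$-basis satisfies, for all words $x$ and $y$ of $\mathsf{Dias}_\gamma$ of arities at least $2$ and every position $i$ of $x$, $$\mathsf{K}^{(\gamma)}_x \circ_i \mathsf{K}^{(\gamma)}_y = \begin{cases} \mathsf{K}^{(\gamma)}_{x \circ_i y} & \text{if } \min(y) > x_i, \\ \sum_{a \in \{x_i, x_i+1, \dots, \gamma\}} \mathsf{K}^{(\gamma)}_{x \circ_{a,i} y} & \text{if } \min(y) = x_i, \\ 0 & \text{otherwise } (\min(y) < x_i). \end{cases}$$
   Context: The ground field has characteristic zero; $[\gamma]=\{1,\dots,\gamma\}$. $\mathsf{Dias}_\gamma$ is the nonsymmetric operad in vector spaces whose arity-$n$ component ($n \geq 1$) has as basis the words of length $n$ on $\{0\} \cup [\gamma]$ with exactly one occurrence of $0$, with partial compositions given linearly by $u \circ_i v := u_1 \dots u_{i-1}\,\max(u_i, v_1) \dots \max(u_i, v_m)\, u_{i+1} \dots u_n$. (It is the suboperad generated by the words $0a, a0$, $a \in [\gamma]$, of the operad of all words on $\{0\}\cup[\gamma]$ with these compositions.) On words of $\mathsf{Dias}_\gamma$ of the same arity $n$, set $x \preccurlyeq_\gamma y$ if $x_i \leq y_i$ for all $i \in \{1,\dots,n\}$, and let $\mu_\gamma$ be the Möbius function of this poset. The $\mathsf{K}$-basis of $\mathsf{Dias}_\gamma$ is the family $\mathsf{K}^{(\gamma)}_x := \sum_{x \preccurlyeq_\gamma x'} \mu_\gamma(x,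 x')\, x'$, for $x$ a word of $\mathsf{Dias}_\gamma$. For a word $y$ of $\mathsf{Dias}_\gamma$ of length at least $2$, $\min(y)$ is the smallest letter of $y$ among its letters different from $0$. For words $x, y$ of $\mathsf{Dias}_\gamma$, a position $i$ with $x_i \neq 0$, and $a \in [\gamma]$, $x \circ_{a,i} y$ denotes the word $x \circ_i y$ in which the letter at the position coming from the $0$ of $y$ (which equals $x_i$ in $x \circ_i y$) is replaced by $a$. -}

module Defs where

open import Algebra.Apartness.Bundles using (HeytingField; HeytingCommutativeRing)
open import Algebra.Bundles using (CommutativeRing)
import Algebra.Construct.NaturalChoice.Max as Max
import Algebra.Definitions.RawMonoid as RawMonoid
open import Data.Bool.Base using (if_then_else_)
open import Data.Empty using (⊥)
open import Data.Fin.Base as Fin using (Fin; zero; suc; fromℕ; toℕ)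
import Data.Fin.Properties as Fin
open import Data.List.Base as List using (List; []; _∷_; allFin; cartesianProductWith; mapMaybe)
import Data.List.Extrema as Extrema
import Data.List.Relation.Unary.All.Properties as All
open import Data.Maybe.Base as Maybe using ()
open import Data.Nat.Base using (ℕ; zero; suc; _+_)
import Data.Nat.Base as ℕ
import Data.Nat.Induction as ℕ
import Data.Nat.Properties as ℕ
open import Data.Product.Base using (_,_)
open import Data.Vec.Base as Vec using (Vec; []; _∷_; _++_; cast; count; lookup)
open import Data.Vec.Properties using (≡-dec)
open import Data.Vec.Relation.Binary.Pointwise.Inductive as Pointwise using (Pointwise; []; _∷_)
open import Function.Base using (_∘_; _on_)
open import Induction.WellFounded using (Acc; acc; WellFounded; module Subrelation)
open import Level using (Level)
import Relation.Binary.Construct.NonStrictToStrict as ToStrict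
import Relation.Binary.Construct.On as On
open import Relation.Binary.PropositionalEquality
  using (_≡_; _≢_; refl; sym; trans; cong; cong₂; subst; isEquivalence; module ≡-Reasoning)
open import Relation.Binary.Structures using (IsDecPartialOrder)
open import Relation.Nullary using (Dec; yes; no; does; ¬_; ¬?; contradiction; contradiction-irr)
open import Relation.Nullary.Decidable using (dec⇒maybe; map′)

private
  variable
    a c ℓ₁ ℓ₂ : Level
    A : Set a
    m n : ℕ

-- insert u i w = u₁ … uᵢ₋₁ w uᵢ₊₁ … uₙ₊₁
insert : Vec A (suc n) → Fin (suc n) → Vec A m → Vec A (n + m)
insert {n = n}     {m = m} (_ ∷ u) zero    w = cast (ℕ.+-comm m n) (w ++ u)
insert {n = suc n}         (a ∷ u) (suc i) w = a ∷ insert u i w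

module Words (γ : ℕ) where

  Letter : Set
  Letter = Fin (suc γ)

  open Max (Fin.≤-totalOrder (suc γ)) public using (_⊔_)
  open Max (Fin.≤-totalOrder (suc γ)) using (x≤x⊔y; x≤y⇒x⊔y≈y)
  open Extrema (Fin.≤-totalOrder (suc γ)) using (min; argmin-all)

  zeros : Vec Letter n → ℕ
  zeros = count (Fin._≟ zero)

  -- The proof field is irrelevant, so two words are equal as soon as their
  -- letters are.
  record Word (n : ℕ) : Set where
    constructor word
    field
      letters  : Vec Letter n
      .oneZero : zeros letters ≡ 1
  open Word public

  letters-injective : {x y : Word n} → letters x ≡ letters y → x ≡ y
  letters-injective refl = refl

  infix 4 _≟_
  _≟_ : (x y : Word n) → Dec (x ≡ y)
  x ≟ y = map′ letters-injective (cong letters) (≡-dec Fin._≟_ (letters x) (letters y))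

  vectors : ∀ n → List (Vec Letter n)
  vectors zero    = [] ∷ []
  vectors (suc n) = cartesianProductWith _∷_ (allFin (suc γ)) (vectors n)

  -- Every word of arity n, exactly once.
  words : ∀ n → List (Word n)
  words n = mapMaybe (λ v → Maybe.map (λ p → word v p) (dec⇒maybe (zeros v ℕ.≟ 1))) (vectors n)

  zeros₁ : Letter → ℕ
  zeros₁ a = zeros (a ∷ [])

  zeros-∷ : ∀ a (v : Vec Letter n) → zeros (a ∷ v) ≡ zeros₁ a + zeros v
  zeros-∷ zero    v = refl
  zeros-∷ (suc a) v = refl

  zeros-++ : (u : Vec Letter m) (v : Vec Letter n) → zeros (u ++ v) ≡ zeros u + zeros v
  zeros-++ []          v = refl
  zeros-++ (zero ∷ u)  v = cong suc (zeros-++ u v)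
  zeros-++ (suc a ∷ u) v = zeros-++ u v

  zeros-cast : .(eq : m ≡ n) (v : Vec Letter m) → zeros (cast eq v) ≡ zeros v
  zeros-cast {n = zero}  eq []          = refl
  zeros-cast {n = suc _} eq (zero ∷ v)  = cong suc (zeros-cast (ℕ.suc-injective eq) v)
  zeros-cast {n = suc _} eq (suc a ∷ v) = zeros-cast (ℕ.suc-injective eq) v

  zeros-insert : (u : Vec Letter (suc n)) (i : Fin (suc n)) (w : Vec Letter m) →
                 zeros₁ (lookup u i) + zeros (insert u i w) ≡ zeros u + zeros w
  zeros-insert {n = n} {m = m} (a ∷ u) zero w = begin
    zeros₁ a + zeros (cast (ℕ.+-comm m n) (w ++ u))
      ≡⟨ cong (zeros₁ a +_) (trans (zeros-cast (ℕ.+-comm m n) (w ++ u)) (zeros-++ w u)) ⟩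
    zeros₁ a + (zeros w + zeros u)
      ≡⟨ cong (zeros₁ a +_) (ℕ.+-comm (zeros w) (zeros u)) ⟩
    zeros₁ a + (zeros u + zeros w)
      ≡⟨ ℕ.+-assoc (zeros₁ a) (zeros u) (zeros w) ⟨
    zeros₁ a + zeros u + zeros w
      ≡⟨ cong (_+ zeros w) (zeros-∷ a u) ⟨
    zeros (a ∷ u) + zeros w ∎
    where open ≡-Reasoning
  zeros-insert {n = suc n} (zero ∷ u) (suc i) w =
    trans (ℕ.+-suc (zeros₁ (lookup u i)) _) (cong suc (zeros-insert u i w))
  zeros-insert {n = suc n} (suc a ∷ u) (suc i) w = zeros-insert u i w

  zeros₁-≢ : ∀ {a} → a ≢ zero → zeros₁ a ≡ 0
  zeros₁-≢ {zero}  a≢0 = contradiction refl a≢0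
  zeros₁-≢ {suc a} _   = refl

  zeros-map-≢ : (f : Letter → Letter) → (∀ b → f b ≢ zero) →
                (v : Vec Letter m) → zeros (Vec.map f v) ≡ 0
  zeros-map-≢ f f≢0 []      = refl
  zeros-map-≢ f f≢0 (b ∷ v) =
    trans (zeros-∷ (f b) (Vec.map f v)) (cong₂ _+_ (zeros₁-≢ (f≢0 b)) (zeros-map-≢ f f≢0 v))

  zeros-map-zero⊔ : (v : Vec Letter m) → zeros (Vec.map (zero ⊔_) v) ≡ zeros v
  zeros-map-zero⊔ []      = refl
  zeros-map-zero⊔ (b ∷ v)
    rewrite x≤y⇒x⊔y≈y {b} {zero} ℕ.z≤n
    = trans (zeros-∷ b (Vec.map (zero ⊔_) v))
        (trans (cong (zeros₁ b +_) (zeros-map-zero⊔ v)) (sym (zeros-∷ b v)))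

  ⊔-≢0 : ∀ {a} b → a ≢ zero → a ⊔ b ≢ zero
  ⊔-≢0 {a} b a≢0 eq =
    a≢0 (Fin.toℕ-injective (ℕ.n≤0⇒n≡0 (subst (a Fin.≤_) eq (x≤x⊔y a b))))

  oneZero-insert-≢ : (u : Vec Letter (suc n)) (i : Fin (suc n)) (w : Vec Letter m) →
                     zeros u ≡ 1 → lookup u i ≢ zero → zeros w ≡ 0 → zeros (insert u i w) ≡ 1
  oneZero-insert-≢ u i w zu uᵢ≢0 zw = trans
    (sym (cong (_+ zeros (insert u i w)) (zeros₁-≢ uᵢ≢0)))
    (trans (zeros-insert u i w) (cong₂ _+_ zu zw))

  oneZero-∘ : (u : Vec Letter (suc n)) (i : Fin (suc n)) (v : Vec Letter m) →
              zeros u ≡ 1 → zeros v ≡ 1 →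
              zeros (insert u i (Vec.map (lookup u i ⊔_) v)) ≡ 1
  oneZero-∘ u i v zu zv with lookup u i in eq
  ... | zero = ℕ.+-cancelˡ-≡ 1 _ _ (trans
    (cong (_+ zeros (insert u i w)) (sym (cong zeros₁ eq)))
    (trans (zeros-insert u i w) (cong₂ _+_ zu (trans (zeros-map-zero⊔ v) zv))))
    where w = Vec.map (zero ⊔_) v
  ... | suc a = oneZero-insert-≢ u i (Vec.map (suc a ⊔_) v) zu
    (λ uᵢ≡0 → contradiction (trans (sym eq) uᵢ≡0) λ ())
    (zeros-map-≢ (suc a ⊔_) (λ b → ⊔-≢0 b λ ()) v)

  infixl 7 _∘[_]_ _∘[_,_∣_]_

  _∘[_]_ : Word (suc n) → Fin (suc n) → Word m → Word (n + m)
  word u pu ∘[ i ] word v pv =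
    word (insert u i (Vec.map (lookup u i ⊔_) v)) (oneZero-∘ u i v pu pv)

  replacing0 : Letter → (Letter → Letter) → Letter → Letter
  replacing0 a f zero    = a
  replacing0 a f (suc b) = f (suc b)

  replacing0-≢ : ∀ {a f} → a ≢ zero → (∀ b → f b ≢ zero) → ∀ b → replacing0 a f b ≢ zero
  replacing0-≢ a≢0 f≢0 zero    = a≢0
  replacing0-≢ a≢0 f≢0 (suc b) = f≢0 (suc b)

  -- x ∘[ a , i ∣ _ ] y is the word x ∘_{a+1,i} y: an element a of Fin γ
  -- stands for the letter suc a of [γ] = {1, …, γ}.
  _∘[_,_∣_]_ : (x : Word (suc n)) → Fin γ → (i : Fin (suc n)) →
               .(lookup (letters x) i ≢ zero) → Word m → Word (n + m)
  word u pu ∘[ a , i ∣ uᵢ≢0 ] word v pv =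
    word (insert u i (Vec.map f v))
         (oneZero-insert-≢ u i (Vec.map f v) pu uᵢ≢0
           (zeros-map-≢ f (replacing0-≢ (λ ()) λ b → ⊔-≢0 b uᵢ≢0) v))
    where f = replacing0 (suc a) (lookup u i ⊔_)

  -- The default value γ given to min is never smaller than a letter, hence
  -- has no influence: a word of arity at least 2 has a nonzero letter.
  minLetter : Word (2 + n) → Letter
  minLetter y = min (fromℕ γ) (List.filter (λ b → ¬? (b Fin.≟ zero)) (Vec.toList (letters y)))

  γ≢0 : Word (2 + n) → fromℕ γ ≢ zero
  γ≢0 (word v p) eq = go v p
    where
    ¬Fin : ¬ Fin γ
    ¬Fin b = Fin.¬Fin0 (subst Fin (trans (sym (Fin.toℕ-fromℕ γ)) (cong toℕ eq)) b)

    go : (v : Vec Letter (2 + n)) → .(zeros v ≡ 1) → ⊥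
    go (suc b ∷ _)        _ = ¬Fin b
    go (zero ∷ suc b ∷ _) _ = ¬Fin b
    go (zero ∷ zero ∷ _)  p = contradiction-irr p λ ()

  minLetter≢0 : (y : Word (2 + n)) → minLetter y ≢ zero
  minLetter≢0 y =
    argmin-all (λ b → b) (γ≢0 y)
      (All.all-filter (λ b → ¬? (b Fin.≟ zero)) (Vec.toList (letters y)))

  minLetter≡⇒≢0 : (y : Word (2 + n)) {b : Letter} → minLetter y ≡ b → b ≢ zero
  minLetter≡⇒≢0 y eq b≡0 = minLetter≢0 y (trans eq b≡0)

  infix 4 _≼_ _≼?_ _≺_ _≺?_

  _≼_ : Word n → Word n → Set
  x ≼ y = Pointwise Fin._≤_ (letters x) (letters y)

  _≼?_ : (x y : Word n) → Dec (x ≼ y)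
  x ≼? y = Pointwise.decidable Fin._≤?_ (letters x) (letters y)

  ≤-antisym : {u v : Vec Letter n} → Pointwise Fin._≤_ u v → Pointwise Fin._≤_ v u → u ≡ v
  ≤-antisym []       []       = refl
  ≤-antisym (p ∷ ps) (q ∷ qs) = cong₂ _∷_ (Fin.≤-antisym p q) (≤-antisym ps qs)

  ≼-isDecPartialOrder : IsDecPartialOrder _≡_ (_≼_ {n})
  ≼-isDecPartialOrder = record
    { isPartialOrder = record
      { isPreorder = record
        { isEquivalence = isEquivalence
        ; reflexive     = λ { refl → Pointwise.refl ℕ.≤-refl }
        ; trans         = Pointwise.trans ℕ.≤-trans
        }
      ; antisym = λ p q → letters-injective (≤-antisym p q)
      }
    ; _≟_  = _≟_
    ; _≤?_ = _≼?_
    }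

  _≺_ : Word n → Word n → Set
  _≺_ = ToStrict._<_ _≡_ _≼_

  _≺?_ : (x y : Word n) → Dec (x ≺ y)
  _≺?_ = ToStrict.<-decidable _≡_ _≼_ _≟_ _≼?_

  weight : Vec Letter n → ℕ
  weight v = Vec.sum (Vec.map toℕ v)

  weight-≤ : {u v : Vec Letter n} → Pointwise Fin._≤_ u v → weight u ℕ.≤ weight v
  weight-≤ []       = ℕ.z≤n
  weight-≤ (p ∷ ps) = ℕ.+-mono-≤ p (weight-≤ ps)

  weight-< : {u v : Vec Letter n} → Pointwise Fin._≤_ u v → u ≢ v → weight u ℕ.< weight v
  weight-< []                              u≢v = contradiction refl u≢v
  weight-< (_∷_ {x = a} {y = b} p ps) u≢v with a Fin.≟ b
  ... | yes refl = ℕ.+-monoʳ-< (toℕ a) (weight-< ps (u≢v ∘ cong (a ∷_)))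
  ... | no a≢b   = ℕ.+-mono-<-≤ (Fin.≤∧≢⇒< p a≢b) (weight-≤ ps)

  ≺-wellFounded : WellFounded (_≺_ {n})
  ≺-wellFounded = Subrelation.wellFounded
    {_<₂_ = ℕ._<_ on (weight ∘ letters)}
    (λ (p , x≢y) → weight-< p (x≢y ∘ letters-injective))
    (On.wellFounded (weight ∘ letters) ℕ.<-wellFounded)

CharacteristicZero : HeytingField c ℓ₁ ℓ₂ → Set ℓ₁
CharacteristicZero F = ∀ n → ¬ (suc n ×′ 1# ≈ 0#)
  where
  open HeytingField F using (_≈_; 0#; 1#; heytingCommutativeRing)
  open HeytingCommutativeRing heytingCommutativeRing using (commutativeRing)
  open CommutativeRing commutativeRing using (+-rawMonoid)
  open RawMonoid +-rawMonoid using () renaming (_×_ to _×′_)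

module Dias (F : HeytingField c ℓ₁ ℓ₂) (γ : ℕ) where

  open Words γ public
  open HeytingField F using (Carrier; _≈_; -_; 0#; 1#) renaming (_+_ to _+ᶠ_; _*_ to _*ᶠ_)

  ∑ : List A → (A → Carrier) → Carrier
  ∑ xs f = List.foldr _+ᶠ_ 0# (List.map f xs)

  -- An element of the arity n component, through its coordinates on the
  -- (finite) basis of words.
  Vector : ℕ → Set c
  Vector n = Word n → Carrier

  infix 4 _≋_
  _≋_ : Vector n → Vector n → Set ℓ₁
  f ≋ g = ∀ w → f w ≈ g w

  0ᵥ : Vector n
  0ᵥ w = 0#

  infixr 8 _•_
  _•_ : Carrier → Vector n → Vector n
  (r • f) w = r *ᶠ f w

  ∑ᵥ : List A → (A → Vector n) → Vector n
  ∑ᵥ xs f w = ∑ xs (λ x → f x w)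

  ⟦_⟧ : Word n → Vector n
  ⟦ x ⟧ w = if does (x ≟ w) then 1# else 0#

  infixl 7 _∘ᵥ[_]_
  _∘ᵥ[_]_ : Vector (suc n) → Fin (suc n) → Vector m → Vector (n + m)
  f ∘ᵥ[ i ] g = ∑ᵥ (words _) λ u → ∑ᵥ (words _) λ v → (f u *ᶠ g v) • ⟦ u ∘[ i ] v ⟧

  -- μ(x, x) = 1, and μ(x, z) = - ∑ μ(x, y) over x ≼ y ≺ z if x ≢ z; the sum
  -- is empty unless x ≼ z.  The values are taken in the ground field.
  μ-acc  : (x z : Word n) → Acc _≺_ z → Carrier
  μ-term : (x z : Word n) → (∀ {y} → y ≺ z → Acc _≺_ y) → Word n → Carrier

  μ-acc {n} x z (acc rs) = if does (x ≟ z) then 1# else - ∑ (words n) (μ-term x z rs)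

  μ-term x z rs y with x ≼? y | y ≺? z
  ... | yes _ | yes y≺z = μ-acc x y (rs y≺z)
  ... | _     | _       = 0#

  μ : Word n → Word n → Carrier
  μ x z = μ-acc x z (≺-wellFounded z)

  K : Word n → Vector n
  K {n} x = ∑ᵥ (List.filter (x ≼?_) (words n)) λ x′ → μ x x′ • ⟦ x′ ⟧

{-# OPTIONS --safe #-}
-- Comparable words have their 0 at the same position, so K x factorises over
-- the letters of x: 0 contributes 0, and a ≠ 0 contributes a − (a + 1), or a if
-- a = γ.  A composition at position i therefore only concerns the letter xᵢ and
-- the factors of y.  Taking the maximum with a letter a sends the factor
-- b − (b + 1) of y to itself if a ≤ b and to 0 if a > b, and the factor 0 to a.
-- Hence a contributes nothing if a > min y, and otherwise y with its 0 replaced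
-- by a; the letters a to consider are those in the factor of xᵢ, all of them in
-- {xᵢ, xᵢ + 1}.  If min y > xᵢ they rebuild the factor of xᵢ.  If min y = xᵢ
-- only xᵢ contributes, and the bare letter xᵢ is the telescoping sum of the
-- factors of xᵢ, …, γ.

module Submission where

open import Defs
open import Algebra.Apartness.Bundles using (HeytingField)
open import Data.Fin using (Fin; suc; _<_; _≤?_)
open import Data.List using (filter; allFin)
open import Data.Nat using (ℕ; _+_)
open import Data.Product using (_×_)
open import Data.Vec using (lookup)
open import Relation.Binary.PropositionalEquality using (_≡_)

open import Algebra.Apartness.Bundles using (HeytingCommutativeRing)
open import Algebra.Bundles using (CommutativeRing)
import Algebra.Construct.NaturalChoice.Max as Max
import Algebra.Properties.CommutativeSemigroup as CommutativeSemigroupProperties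
import Algebra.Properties.Ring as RingProperties
import Algebra.Solver.CommutativeMonoid as CommutativeMonoidSolver
open import Data.Bool.Base using (true; false; if_then_else_)
open import Data.Fin using (zero; fromℕ; toℕ; _≤_)
import Data.Fin.Properties as Fin
open import Data.List using (List; []; _∷_; map; _++_; cartesianProductWith; mapMaybe)
import Data.List.Extrema as Extrema
import Data.List.Membership.Propositional.Properties as ListMembership
import Data.List.Properties as List
import Data.List.Relation.Unary.All as ListAll
import Data.Maybe.Base as Maybe
open import Data.Nat using (zero; suc)
import Data.Nat as ℕ
import Data.Nat.Properties as ℕ
open import Data.Product using (_,_; proj₁; proj₂)
open import Data.Sum using (inj₁; inj₂)
open import Data.Vec using (Vec; []; _∷_; cast; splitAt)
import Data.Vec as Vec
open import Data.Vec.Membership.Propositional using (_∈_)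
import Data.Vec.Membership.Propositional.Properties as VecMembership
import Data.Vec.Properties as Vec
open import Data.Vec.Relation.Binary.Pointwise.Inductive as Pointwise using (Pointwise; []; _∷_)
open import Data.Vec.Relation.Unary.Any using (here; there)
open import Function using (_∘_)
open import Induction.WellFounded using (Acc; acc)
open import Level using (Level)
open import Relation.Binary.Definitions using (tri<; tri≈; tri>)
open import Relation.Binary.PropositionalEquality as ≡ using (_≢_)
import Relation.Binary.Reasoning.Setoid as SetoidReasoning
open import Relation.Nullary using (Dec; yes; no; does; ¬_; ¬?; contradiction; recompute)
open import Relation.Nullary.Decidable using (dec⇒maybe; dec-true; dec-false)

module KBasis {c ℓ₁ ℓ₂} (F : HeytingField c ℓ₁ ℓ₂) (γ : ℕ) where

  open Dias F γ
  open CommutativeRing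
    (HeytingCommutativeRing.commutativeRing (HeytingField.heytingCommutativeRing F))
    renaming (_+_ to _+ᶠ_; _*_ to _*ᶠ_)
    hiding (zero)
  open RingProperties ring using (-0#≈0#; +-inverseˡ-unique; -1*x≈-x)
  open Max (Fin.≤-totalOrder (suc γ)) using (x≤y⇒x⊔y≈y; x≤y⇒y⊔x≈y)
  open CommutativeSemigroupProperties *-commutativeSemigroup using (interchange; x∙yz≈y∙xz)
  module + = CommutativeSemigroupProperties +-commutativeSemigroup
  open CommutativeMonoidSolver *-commutativeMonoid using (solve; _⊕_; _⊜_)
  open SetoidReasoning setoid

  private
    variable
      a p : Level
      A B : Set a
      k m n : ℕ

  -- Indicators of decided propositions and the Kronecker delta

  𝟙 : Dec A → Carrier
  𝟙 d = if does d then 1# else 0#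

  𝟙-true : (d : Dec A) → A → 𝟙 d ≈ 1#
  𝟙-true d x rewrite dec-true d x = refl

  𝟙-false : (d : Dec A) → ¬ A → 𝟙 d ≈ 0#
  𝟙-false d ¬x rewrite dec-false d ¬x = refl

  𝟙-cong : (d : Dec A) (e : Dec B) → (A → B) → (B → A) → 𝟙 d ≈ 𝟙 e
  𝟙-cong (yes x) e f g = sym (𝟙-true e (f x))
  𝟙-cong (no ¬x) e f g = sym (𝟙-false e (¬x ∘ g))

  δ : Fin k → Fin k → Carrier
  δ a b = 𝟙 (a Fin.≟ b)

  zeroˡ′ : ∀ {r s} → r ≈ 0# → r *ᶠ s ≈ 0#
  zeroˡ′ {s = s} r≈0 = trans (*-congʳ r≈0) (zeroˡ s)

  zeroʳ′ : ∀ {r s} → s ≈ 0# → r *ᶠ s ≈ 0#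
  zeroʳ′ {r = r} s≈0 = trans (*-congˡ s≈0) (zeroʳ r)

  -- Finite sums

  ∑-cong : (xs : List A) {f g : A → Carrier} → (∀ x → f x ≈ g x) → ∑ xs f ≈ ∑ xs g
  ∑-cong []       f≈g = refl
  ∑-cong (x ∷ xs) f≈g = +-cong (f≈g x) (∑-cong xs f≈g)

  ∑-zero : (xs : List A) {f : A → Carrier} → (∀ x → f x ≈ 0#) → ∑ xs f ≈ 0#
  ∑-zero []       f≈0 = refl
  ∑-zero (x ∷ xs) f≈0 = trans (+-cong (f≈0 x) (∑-zero xs f≈0)) (+-identityˡ 0#)

  ∑-+ : (xs : List A) (f g : A → Carrier) → ∑ xs f +ᶠ ∑ xs g ≈ ∑ xs (λ x → f x +ᶠ g x)
  ∑-+ []       f g = +-identityˡ 0#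
  ∑-+ (x ∷ xs) f g = trans (+.interchange (f x) (∑ xs f) (g x) (∑ xs g)) (+-congˡ (∑-+ xs f g))

  ∑-*ˡ : (r : Carrier) (xs : List A) (f : A → Carrier) → ∑ xs (λ x → r *ᶠ f x) ≈ r *ᶠ ∑ xs f
  ∑-*ˡ r []       f = sym (zeroʳ r)
  ∑-*ˡ r (x ∷ xs) f = trans (+-congˡ (∑-*ˡ r xs f)) (sym (distribˡ r (f x) (∑ xs f)))

  ∑-*ʳ : (r : Carrier) (xs : List A) (f : A → Carrier) → ∑ xs (λ x → f x *ᶠ r) ≈ ∑ xs f *ᶠ r
  ∑-*ʳ r xs f =
    trans (∑-cong xs (λ x → *-comm (f x) r)) (trans (∑-*ˡ r xs f) (*-comm r (∑ xs f)))

  ∑-× : (xs : List A) (ys : List B) (f : A → Carrier) (g : B → Carrier) →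
        ∑ xs (λ x → ∑ ys (λ y → f x *ᶠ g y)) ≈ ∑ xs f *ᶠ ∑ ys g
  ∑-× xs ys f g = trans (∑-cong xs (λ x → ∑-*ˡ (f x) ys g)) (∑-*ʳ (∑ ys g) xs f)

  ∑-++ : (xs ys : List A) (f : A → Carrier) → ∑ (xs ++ ys) f ≈ ∑ xs f +ᶠ ∑ ys f
  ∑-++ []       ys f = sym (+-identityˡ (∑ ys f))
  ∑-++ (x ∷ xs) ys f = trans (+-congˡ (∑-++ xs ys f)) (sym (+-assoc (f x) (∑ xs f) (∑ ys f)))

  ∑-map : (h : A → B) (xs : List A) (f : B → Carrier) → ∑ (map h xs) f ≈ ∑ xs (f ∘ h)
  ∑-map h []       f = refl
  ∑-map h (x ∷ xs) f = +-congˡ (∑-map h xs f)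

  ∑-filter : {P : A → Set p} (P? : ∀ x → Dec (P x)) (xs : List A) (f : A → Carrier) →
             ∑ (filter P? xs) f ≈ ∑ xs (λ x → 𝟙 (P? x) *ᶠ f x)
  ∑-filter P? []       f = refl
  ∑-filter P? (x ∷ xs) f with does (P? x)
  ... | true  = +-cong (sym (*-identityˡ (f x))) (∑-filter P? xs f)
  ... | false = trans (∑-filter P? xs f)
    (trans (sym (+-identityˡ _)) (+-congʳ (sym (zeroˡ (f x)))))

  ∑-cartesianProductWith : ∀ {b c} {B : Set b} {C : Set c}
    (h : A → B → C) (xs : List A) (ys : List B) (f : C → Carrier) →
    ∑ (cartesianProductWith h xs ys) f ≈ ∑ xs (λ x → ∑ ys (λ y → f (h x y)))
  ∑-cartesianProductWith h []       ys f = refl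
  ∑-cartesianProductWith h (x ∷ xs) ys f = trans
    (∑-++ (map (h x) ys) (cartesianProductWith h xs ys) f)
    (+-cong (∑-map (h x) ys f) (∑-cartesianProductWith h xs ys f))

  ∑-allFin : (f : Fin (suc k) → Carrier) → ∑ (allFin (suc k)) f ≈ f zero +ᶠ ∑ (allFin k) (f ∘ suc)
  ∑-allFin {k} f = +-congˡ (trans
    (reflexive (≡.cong (λ xs → ∑ xs f) (≡.sym (List.map-tabulate (λ i → i) suc))))
    (∑-map suc (allFin k) f))

  ∑-δ : (f : Fin k → Carrier) (c : Fin k) → ∑ (allFin k) (λ b → f b *ᶠ δ b c) ≈ f c
  ∑-δ {suc k} f zero = begin
    ∑ (allFin (suc k)) (λ b → f b *ᶠ δ b zero)
      ≈⟨ ∑-allFin (λ b → f b *ᶠ δ b zero) ⟩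
    f zero *ᶠ 1# +ᶠ ∑ (allFin k) (λ b → f (suc b) *ᶠ 0#)
      ≈⟨ +-cong (*-identityʳ _) (∑-zero (allFin k) (λ b → zeroʳ _)) ⟩
    f zero +ᶠ 0#
      ≈⟨ +-identityʳ _ ⟩
    f zero ∎
  ∑-δ {suc k} f (suc c) = begin
    ∑ (allFin (suc k)) (λ b → f b *ᶠ δ b (suc c))
      ≈⟨ ∑-allFin (λ b → f b *ᶠ δ b (suc c)) ⟩
    f zero *ᶠ 0# +ᶠ ∑ (allFin k) (λ b → f (suc b) *ᶠ δ b c)
      ≈⟨ +-cong (zeroʳ _) (∑-δ (f ∘ suc) c) ⟩
    0# +ᶠ f (suc c)
      ≈⟨ +-identityˡ _ ⟩
    f (suc c) ∎

  -- Tensor products of matrices indexed by letters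

  Matrix : Set c
  Matrix = Letter → Letter → Carrier

  -- The entry in row `x` and column `w` of a Kronecker power of `f`.
  ⊗ : Matrix → Vec Letter n → Vec Letter n → Carrier
  ⊗ f []      []      = 1#
  ⊗ f (a ∷ x) (b ∷ w) = f a b *ᶠ ⊗ f x w

  infixl 7 _⋆_
  _⋆_ : Matrix → Matrix → Matrix
  (f ⋆ g) a c = ∑ (allFin (suc γ)) (λ b → f a b *ᶠ g b c)

  ⋆-δ : (f : Matrix) → ∀ a b → (f ⋆ δ) a b ≈ f a b
  ⋆-δ f a b = ∑-δ (f a) b

  -- Asking for agreement only on the rows of letters of `x` lets a lower bound on these letters be
  -- used row by row.
  ⊗-cong-∈ : {f g : Matrix} (x w : Vec Letter n) →
             (∀ {a} → a ∈ x → ∀ b → f a b ≈ g a b) → ⊗ f x w ≈ ⊗ g x w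
  ⊗-cong-∈ []      []      f≈g = refl
  ⊗-cong-∈ (a ∷ x) (b ∷ w) f≈g =
    *-cong (f≈g (here ≡.refl) b) (⊗-cong-∈ x w (f≈g ∘ there))

  ⊗-cong : {f g : Matrix} → (∀ a b → f a b ≈ g a b) →
           (x w : Vec Letter n) → ⊗ f x w ≈ ⊗ g x w
  ⊗-cong f≈g x w = ⊗-cong-∈ x w (λ {a} _ → f≈g a)

  ⊗-zero-∈ : {f : Matrix} {a : Letter} {x : Vec Letter n} (w : Vec Letter n) →
             a ∈ x → (∀ b → f a b ≈ 0#) → ⊗ f x w ≈ 0#
  ⊗-zero-∈ (b ∷ w) (here ≡.refl) fa≈0 = zeroˡ′ (fa≈0 b)
  ⊗-zero-∈ (b ∷ w) (there a∈x)   fa≈0 = zeroʳ′ (⊗-zero-∈ w a∈x fa≈0)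

  ⊗-map : (f : Matrix) (h : Letter → Letter) (x w : Vec Letter n) →
          ⊗ f (Vec.map h x) w ≈ ⊗ (f ∘ h) x w
  ⊗-map f h []      []      = refl
  ⊗-map f h (a ∷ x) (b ∷ w) = *-congˡ (⊗-map f h x w)

  ⊗-++ : (f : Matrix) (x w : Vec Letter m) (x′ w′ : Vec Letter n) →
         ⊗ f (x Vec.++ x′) (w Vec.++ w′) ≈ ⊗ f x w *ᶠ ⊗ f x′ w′
  ⊗-++ f []      []      x′ w′ = sym (*-identityˡ _)
  ⊗-++ f (a ∷ x) (b ∷ w) x′ w′ = trans (*-congˡ (⊗-++ f x w x′ w′)) (sym (*-assoc _ _ _))

  ⊗-cast : (f : Matrix) .(eq : m ≡ n) (x w : Vec Letter m) →
           ⊗ f (cast eq x) (cast eq w) ≈ ⊗ f x w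
  ⊗-cast {n = zero}  f eq []      []      = refl
  ⊗-cast {n = suc _} f eq (a ∷ x) (b ∷ w) = *-congˡ (⊗-cast f (ℕ.suc-injective eq) x w)

  ∑-vectors : (f : Vec Letter (suc n) → Carrier) →
    ∑ (vectors (suc n)) f ≈ ∑ (allFin (suc γ)) (λ a → ∑ (vectors n) (λ v → f (a ∷ v)))
  ∑-vectors {n} f = ∑-cartesianProductWith _∷_ (allFin (suc γ)) (vectors n) f

  -- Mixed-product rule for Kronecker powers: by distributivity, the sum over all vectors splits
  -- into one sum per letter.
  ⊗-⋆ : (f g : Matrix) (x z : Vec Letter n) →
        ∑ (vectors n) (λ v → ⊗ f x v *ᶠ ⊗ g v z) ≈ ⊗ (f ⋆ g) x z
  ⊗-⋆ f g [] [] = trans (+-identityʳ _) (*-identityˡ 1#)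
  ⊗-⋆ {suc n} f g (a ∷ x) (c ∷ z) = begin
    ∑ (vectors (suc n)) (λ v → ⊗ f (a ∷ x) v *ᶠ ⊗ g v (c ∷ z))
      ≈⟨ ∑-vectors (λ v → ⊗ f (a ∷ x) v *ᶠ ⊗ g v (c ∷ z)) ⟩
    ∑ (allFin (suc γ)) (λ b → ∑ (vectors n) (λ v → (f a b *ᶠ ⊗ f x v) *ᶠ (g b c *ᶠ ⊗ g v z)))
      ≈⟨ ∑-cong (allFin (suc γ)) (λ b → ∑-cong (vectors n) (λ v → interchange _ _ _ _)) ⟩
    ∑ (allFin (suc γ)) (λ b → ∑ (vectors n) (λ v → (f a b *ᶠ g b c) *ᶠ (⊗ f x v *ᶠ ⊗ g v z)))
      ≈⟨ ∑-× (allFin (suc γ)) (vectors n) _ _ ⟩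
    (f ⋆ g) a c *ᶠ ∑ (vectors n) (λ v → ⊗ f x v *ᶠ ⊗ g v z)
      ≈⟨ *-congˡ (⊗-⋆ f g x z) ⟩
    (f ⋆ g) a c *ᶠ ⊗ (f ⋆ g) x z ∎

  ⊗-δ-refl : (x : Vec Letter n) → ⊗ δ x x ≈ 1#
  ⊗-δ-refl []      = refl
  ⊗-δ-refl (a ∷ x) =
    trans (*-cong (𝟙-true (a Fin.≟ a) ≡.refl) (⊗-δ-refl x)) (*-identityˡ 1#)

  ⊗-δ-≢ : (x w : Vec Letter n) → x ≢ w → ⊗ δ x w ≈ 0#
  ⊗-δ-≢ []      []      x≢w = contradiction ≡.refl x≢w
  ⊗-δ-≢ (a ∷ x) (b ∷ w) x≢w with a Fin.≟ b
  ... | yes ≡.refl = zeroʳ′ (⊗-δ-≢ x w (x≢w ∘ ≡.cong (a ∷_)))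
  ... | no _       = zeroˡ _

  ⟦⟧-⊗ : (x w : Word n) → ⟦ x ⟧ w ≈ ⊗ δ (letters x) (letters w)
  ⟦⟧-⊗ x w = helper (x ≟ w)
    where
    helper : (d : Dec (x ≡ w)) → 𝟙 d ≈ ⊗ δ (letters x) (letters w)
    helper (yes ≡.refl) = sym (⊗-δ-refl (letters x))
    helper (no x≢w)     = sym (⊗-δ-≢ (letters x) (letters w) (x≢w ∘ letters-injective))

  -- Letter factors of the K-basis

  -- The Möbius function of a chain of `k` elements. In `κ` the index `a` stands for the letter
  -- `a + 1`; the size stays variable so that inductions can drop the first element.
  κ⁺ : Fin k → Fin k → Carrier
  κ⁺ zero    zero          = 1#
  κ⁺ zero    (suc zero)    = - 1#
  κ⁺ zero    (suc (suc b)) = 0#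
  κ⁺ (suc a) zero          = 0#
  κ⁺ (suc a) (suc b)       = κ⁺ a b

  -- ⊗ κ x is the coordinate vector of K x: the letter 0 of x stands for
  -- itself, and a letter a ≠ 0 for a − (a + 1), with a + 1 absent if a = γ.
  κ : Matrix
  κ zero    zero    = 1#
  κ zero    (suc b) = 0#
  κ (suc a) zero    = 0#
  κ (suc a) (suc b) = κ⁺ a b

  -- The value at `a` minus the value at `a + 1`, where a value past the last index counts as 0; the
  -- one-element clause is this boundary case.
  Δ : (Fin k → Carrier) → Fin k → Carrier
  Δ {suc zero}    f zero    = f zero
  Δ {suc (suc k)} f zero    = f zero - f (suc zero)
  Δ                 f (suc a) = Δ (f ∘ suc) a

  -- Row `a` of `κ⁺` has 1 on the diagonal, -1 just after it if there is room, and zeros elsewhere.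
  ∑-κ⁺ : (f : Fin k → Carrier) (a : Fin k) → ∑ (allFin k) (λ b → κ⁺ a b *ᶠ f b) ≈ Δ f a
  ∑-κ⁺ {suc zero} f zero = trans (+-identityʳ _) (*-identityˡ _)
  ∑-κ⁺ {suc (suc k)} f zero = begin
    ∑ (allFin (2 + k)) (λ b → κ⁺ zero b *ᶠ f b)
      ≈⟨ trans (∑-allFin (λ b → κ⁺ zero b *ᶠ f b))
           (+-congˡ (∑-allFin (λ b → κ⁺ zero (suc b) *ᶠ f (suc b)))) ⟩
    1# *ᶠ f zero +ᶠ (- 1# *ᶠ f (suc zero) +ᶠ ∑ (allFin k) (λ b → 0# *ᶠ f (suc (suc b))))
      ≈⟨ +-cong (*-identityˡ _)
           (+-cong (-1*x≈-x _)
                   (∑-zero (allFin k) (λ b → zeroˡ _))) ⟩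
    f zero +ᶠ (- f (suc zero) +ᶠ 0#)
      ≈⟨ +-congˡ (+-identityʳ _) ⟩
    f zero - f (suc zero) ∎
  ∑-κ⁺ {suc k} f (suc a) = begin
    ∑ (allFin (suc k)) (λ b → κ⁺ (suc a) b *ᶠ f b)
      ≈⟨ ∑-allFin (λ b → κ⁺ (suc a) b *ᶠ f b) ⟩
    0# *ᶠ f zero +ᶠ ∑ (allFin k) (λ b → κ⁺ a b *ᶠ f (suc b))
      ≈⟨ +-cong (zeroˡ _) (∑-κ⁺ (f ∘ suc) a) ⟩
    0# +ᶠ Δ (f ∘ suc) a
      ≈⟨ +-identityˡ _ ⟩
    Δ (f ∘ suc) a ∎

  κ-⋆-zero : (g : Matrix) (c : Letter) → (κ ⋆ g) zero c ≈ g zero c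
  κ-⋆-zero g c = begin
    (κ ⋆ g) zero c
      ≈⟨ ∑-allFin (λ b → κ zero b *ᶠ g b c) ⟩
    1# *ᶠ g zero c +ᶠ ∑ (allFin γ) (λ b → 0# *ᶠ g (suc b) c)
      ≈⟨ +-cong (*-identityˡ _) (∑-zero (allFin γ) (λ b → zeroˡ _)) ⟩
    g zero c +ᶠ 0#
      ≈⟨ +-identityʳ _ ⟩
    g zero c ∎

  κ-⋆-suc : (g : Matrix) (a : Fin γ) (c : Letter) → (κ ⋆ g) (suc a) c ≈ Δ (λ b → g (suc b) c) a
  κ-⋆-suc g a c = begin
    (κ ⋆ g) (suc a) c
      ≈⟨ ∑-allFin (λ b → κ (suc a) b *ᶠ g b c) ⟩
    0# *ᶠ g zero c +ᶠ ∑ (allFin γ) (λ b → κ⁺ a b *ᶠ g (suc b) c)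
      ≈⟨ +-cong (zeroˡ _) (∑-κ⁺ _ a) ⟩
    0# +ᶠ Δ (λ b → g (suc b) c) a
      ≈⟨ +-identityˡ _ ⟩
    Δ (λ b → g (suc b) c) a ∎

  Δ-cong : {f g : Fin k → Carrier} → (∀ b → f b ≈ g b) → ∀ a → Δ f a ≈ Δ g a
  Δ-cong {suc zero}    f≈g zero    = f≈g zero
  Δ-cong {suc (suc k)} f≈g zero    = +-cong (f≈g zero) (-‿cong (f≈g (suc zero)))
  Δ-cong                 f≈g (suc a) = Δ-cong (f≈g ∘ suc) a

  Δ-zero : {f : Fin k → Carrier} → (∀ b → f b ≈ 0#) → ∀ a → Δ f a ≈ 0#
  Δ-zero {suc zero}    f≈0 zero    = f≈0 zero
  Δ-zero {suc (suc k)} f≈0 zero    =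
    trans (+-cong (f≈0 zero) (trans (-‿cong (f≈0 (suc zero))) -0#≈0#)) (+-identityʳ _)
  Δ-zero                 f≈0 (suc a) = Δ-zero (f≈0 ∘ suc) a

  -- The indicator of being at most `c` drops from 1 to 0 only on leaving `c`; if `c` is the last
  -- index, the boundary value 0 in `Δ` supplies the drop.
  Δ-≤ : (c a : Fin k) → Δ (λ b → 𝟙 (b ≤? c)) a ≈ δ a c
  Δ-≤ {suc zero}    zero    zero    = refl
  Δ-≤ {suc (suc k)} zero    zero    = trans (+-congˡ -0#≈0#) (+-identityʳ _)
  Δ-≤ {suc (suc k)} (suc c) zero    = -‿inverseʳ 1#
  Δ-≤ {suc (suc k)} zero    (suc a) = Δ-zero (λ b → refl) a
  Δ-≤ {suc (suc k)} (suc c) (suc a) = trans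
    (Δ-cong (λ b → 𝟙-cong (suc b ≤? suc c) (b ≤? c) ℕ.s≤s⁻¹ ℕ.s≤s) a)
    (Δ-≤ c a)

  -- As `b < a`, the successor of `b` exists and is still at most `a`, so both values in the
  -- difference are `r`.
  Δ-constant : {f : Fin k → Carrier} {r : Carrier} {a b : Fin k} →
               (∀ b → b ≤ a → f b ≈ r) → b < a → Δ f b ≈ 0#
  Δ-constant {suc (suc k)} {a = suc a} {zero} f≈r b<a = trans
    (+-cong (f≈r zero ℕ.z≤n) (-‿cong (f≈r (suc zero) (ℕ.s≤s ℕ.z≤n)))) (-‿inverseʳ _)
  Δ-constant {suc k} {a = suc a} {suc b} f≈r b<a =
    Δ-constant (λ b b≤a → f≈r (suc b) (ℕ.s≤s b≤a)) (ℕ.s≤s⁻¹ b<a)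

  -- Support and column sums of the letter factors

  κ⁺-diagonal : (a : Fin k) → κ⁺ a a ≈ 1#
  κ⁺-diagonal zero    = refl
  κ⁺-diagonal (suc a) = κ⁺-diagonal a

  κ-diagonal : ∀ a → κ a a ≈ 1#
  κ-diagonal zero    = refl
  κ-diagonal (suc a) = κ⁺-diagonal a

  κ⁺-≰ : (a b : Fin k) → ¬ a ≤ b → κ⁺ a b ≈ 0#
  κ⁺-≰ zero    b       a≰b = contradiction ℕ.z≤n a≰b
  κ⁺-≰ (suc a) zero    a≰b = refl
  κ⁺-≰ (suc a) (suc b) a≰b = κ⁺-≰ a b (a≰b ∘ ℕ.s≤s)

  κ-≰ : ∀ a b → ¬ a ≤ b → κ a b ≈ 0#
  κ-≰ zero    b       a≰b = contradiction ℕ.z≤n a≰b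
  κ-≰ (suc a) zero    a≰b = refl
  κ-≰ (suc a) (suc b) a≰b = κ⁺-≰ a b (a≰b ∘ ℕ.s≤s)

  -- The bound is stated in natural numbers because the last index has no successor in `Fin k`.
  κ⁺-> : (a b : Fin k) → ¬ toℕ b ℕ.≤ suc (toℕ a) → κ⁺ a b ≈ 0#
  κ⁺-> zero    zero          b≰a+1 = contradiction ℕ.z≤n b≰a+1
  κ⁺-> zero    (suc zero)    b≰a+1 = contradiction (ℕ.s≤s ℕ.z≤n) b≰a+1
  κ⁺-> zero    (suc (suc b)) b≰a+1 = refl
  κ⁺-> (suc a) zero          b≰a+1 = refl
  κ⁺-> (suc a) (suc b)       b≰a+1 = κ⁺-> a b (b≰a+1 ∘ ℕ.s≤s)

  κ-> : ∀ a b → ¬ toℕ b ℕ.≤ suc (toℕ a) → κ a b ≈ 0#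
  κ-> zero    zero    b≰a+1 = contradiction ℕ.z≤n b≰a+1
  κ-> zero    (suc b) b≰a+1 = refl
  κ-> (suc a) zero    b≰a+1 = refl
  κ-> (suc a) (suc b) b≰a+1 = κ⁺-> a b (b≰a+1 ∘ ℕ.s≤s)

  -- Every column but the first has a -1 directly above its diagonal 1, and the two cancel.
  ∑-κ⁺-column : (c : Fin (suc k)) → ∑ (allFin (suc k)) (λ b → κ⁺ b c) ≈ δ zero c
  ∑-κ⁺-column {k} zero = trans (∑-allFin {k} (λ b → κ⁺ b zero))
    (trans (+-congˡ (∑-zero (allFin k) (λ b → refl))) (+-identityʳ _))
  ∑-κ⁺-column {suc k} (suc c) =
    trans (∑-allFin (λ b → κ⁺ b (suc c))) (trans (+-congˡ (∑-κ⁺-column c)) (cancel c))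
    where
    cancel : (c : Fin (suc k)) → κ⁺ zero (suc c) +ᶠ δ zero c ≈ 0#
    cancel zero    = -‿inverseˡ 1#
    cancel (suc c) = +-identityʳ 0#

  -- Telescoping, read at coordinate `c`: the differences b - (b + 1) over b ≥ a add up to a alone.
  -- Dropping the rows before `a` reduces this to a full column sum.
  ∑-κ⁺-≥ : (a c : Fin k) → ∑ (allFin k) (λ b → 𝟙 (a ≤? b) *ᶠ κ⁺ b c) ≈ δ a c
  ∑-κ⁺-≥ {suc k} zero c = trans
    (∑-cong (allFin (suc k)) (λ b → *-identityˡ _)) (∑-κ⁺-column c)
  ∑-κ⁺-≥ {suc k} (suc a) zero = begin
    ∑ (allFin (suc k)) (λ b → 𝟙 (suc a ≤? b) *ᶠ κ⁺ b zero)
      ≈⟨ ∑-allFin {k = k} (λ b → 𝟙 (suc a ≤? b) *ᶠ κ⁺ b zero) ⟩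
    0# *ᶠ 1# +ᶠ ∑ (allFin k) (λ b → 𝟙 (suc a ≤? suc b) *ᶠ 0#)
      ≈⟨ +-cong (zeroˡ 1#) (∑-zero (allFin k) (λ b → zeroʳ _)) ⟩
    0# +ᶠ 0#
      ≈⟨ +-identityˡ 0# ⟩
    0# ∎
  ∑-κ⁺-≥ {suc k} (suc a) (suc c) = begin
    ∑ (allFin (suc k)) (λ b → 𝟙 (suc a ≤? b) *ᶠ κ⁺ b (suc c))
      ≈⟨ ∑-allFin (λ b → 𝟙 (suc a ≤? b) *ᶠ κ⁺ b (suc c)) ⟩
    0# *ᶠ κ⁺ zero (suc c) +ᶠ ∑ (allFin k) (λ b → 𝟙 (suc a ≤? suc b) *ᶠ κ⁺ b c)
      ≈⟨ +-cong (zeroˡ _) (∑-cong (allFin k)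
           (λ b → *-congʳ (𝟙-cong (suc a ≤? suc b) (a ≤? b) ℕ.s≤s⁻¹ ℕ.s≤s))) ⟩
    0# +ᶠ ∑ (allFin k) (λ b → 𝟙 (a ≤? b) *ᶠ κ⁺ b c)
      ≈⟨ trans (+-identityˡ _) (∑-κ⁺-≥ a c) ⟩
    δ a c ∎

  ∑-κ-≥ : (a c : Letter) → a ≢ zero →
          ∑ (allFin γ) (λ b → 𝟙 (a ≤? suc b) *ᶠ κ (suc b) c) ≈ δ a c
  ∑-κ-≥ zero    c       a≢0 = contradiction ≡.refl a≢0
  ∑-κ-≥ (suc a) zero    a≢0 = ∑-zero (allFin γ) (λ b → zeroʳ _)
  ∑-κ-≥ (suc a) (suc c) a≢0 = trans
    (∑-cong (allFin γ) (λ b → *-congʳ (𝟙-cong (suc a ≤? suc b) (a ≤? b) ℕ.s≤s⁻¹ ℕ.s≤s)))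
    (∑-κ⁺-≥ a c)

  -- The zeros of two comparable words are at the same position, so ζ need not
  -- relate 0 to the other letters.
  ζ : Matrix
  ζ zero    zero    = 1#
  ζ zero    (suc c) = 0#
  ζ (suc a) zero    = 0#
  ζ (suc a) (suc c) = 𝟙 (a ≤? c)

  -- Möbius inversion for a single letter: on nonzero letters these are the Möbius and zeta matrices
  -- of a chain, and 0 is isolated in both.
  κ⋆ζ : ∀ a c → (κ ⋆ ζ) a c ≈ δ a c
  κ⋆ζ zero    zero    = κ-⋆-zero ζ zero
  κ⋆ζ zero    (suc c) = κ-⋆-zero ζ (suc c)
  κ⋆ζ (suc a) zero    = trans (κ-⋆-suc ζ a zero) (Δ-zero (λ b → refl) a)
  κ⋆ζ (suc a) (suc c) = trans (κ-⋆-suc ζ a (suc c)) (Δ-≤ c a)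

  ζ-≰ : ∀ a b → ¬ a ≤ b → ζ a b ≈ 0#
  ζ-≰ zero    b       a≰b = contradiction ℕ.z≤n a≰b
  ζ-≰ (suc a) zero    a≰b = refl
  ζ-≰ (suc a) (suc b) a≰b = 𝟙-false (a ≤? b) (a≰b ∘ ℕ.s≤s)

  ⊗-≰ : (f : Matrix) → (∀ a b → ¬ a ≤ b → f a b ≈ 0#) →
        (x w : Vec Letter n) → ¬ Pointwise _≤_ x w → ⊗ f x w ≈ 0#
  ⊗-≰ f f≈0 []      []      x≰w = contradiction [] x≰w
  ⊗-≰ f f≈0 (a ∷ x) (b ∷ w) x≰w with a ≤? b
  ... | yes a≤b = zeroʳ′ (⊗-≰ f f≈0 x w (x≰w ∘ (a≤b ∷_)))
  ... | no a≰b  = zeroˡ′ (f≈0 a b a≰b)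

  -- Only 0 lies below 0, so every zero of `w` sits over a zero of `x`.
  zeros-antitone : {x w : Vec Letter n} → Pointwise _≤_ x w → zeros w ℕ.≤ zeros x
  zeros-antitone [] = ℕ.z≤n
  zeros-antitone (_∷_ {x = zero}  {y = zero}  _ x≤w) = ℕ.s≤s (zeros-antitone x≤w)
  zeros-antitone (_∷_ {x = zero}  {y = suc _} _ x≤w) = ℕ.m≤n⇒m≤1+n (zeros-antitone x≤w)
  zeros-antitone (_∷_ {x = suc _} {y = suc _} _ x≤w) = zeros-antitone x≤w

  ⊗-ζ-≤ : {x w : Vec Letter n} → Pointwise _≤_ x w → zeros x ℕ.≤ zeros w → ⊗ ζ x w ≈ 1#
  ⊗-ζ-≤ [] _ = refl
  ⊗-ζ-≤ (_∷_ {x = zero}  {y = zero}  _ x≤w) z =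
    trans (*-identityˡ _) (⊗-ζ-≤ x≤w (ℕ.s≤s⁻¹ z))
  -- A nonzero letter over a 0 would leave `w` with fewer zeros than `x`.
  ⊗-ζ-≤ (_∷_ {x = zero}  {y = suc _} _ x≤w) z =
    contradiction (ℕ.≤-trans z (zeros-antitone x≤w)) (ℕ.<-irrefl ≡.refl)
  ⊗-ζ-≤ (_∷_ {x = suc a} {y = suc b} a≤b x≤w) z =
    trans (*-cong (𝟙-true (a ≤? b) (ℕ.s≤s⁻¹ a≤b)) (⊗-ζ-≤ x≤w z)) (*-identityˡ 1#)

  -- `κ` pairs 0 only with 0, so a nonzero entry forces the zeros into the same positions.
  ⊗-κ-zeros : (x w : Vec Letter n) → zeros w ≢ zeros x → ⊗ κ x w ≈ 0#
  ⊗-κ-zeros []          []          z = contradiction ≡.refl z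
  ⊗-κ-zeros (zero ∷ x)  (zero ∷ w)  z = zeroʳ′ (⊗-κ-zeros x w (z ∘ ≡.cong suc))
  ⊗-κ-zeros (zero ∷ x)  (suc b ∷ w) z = zeroˡ _
  ⊗-κ-zeros (suc a ∷ x) (zero ∷ w)  z = zeroˡ _
  ⊗-κ-zeros (suc a ∷ x) (suc b ∷ w) z = zeroʳ′ (⊗-κ-zeros x w z)

  -- The Möbius function

  zeros≡1 : (x : Word n) → zeros (letters x) ≡ 1
  zeros≡1 (word v p) = recompute (zeros v ℕ.≟ 1) p

  -- Extends a sum to all vectors, where it can be factorised letter by letter.
  ∑-words : (f : Vec Letter n → Carrier) → (∀ v → zeros v ≢ 1 → f v ≈ 0#) →
            ∑ (words n) (f ∘ letters) ≈ ∑ (vectors n) f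
  ∑-words {n} f f≈0 = go (vectors n)
    where
    go : (vs : List (Vec Letter n)) →
         ∑ (mapMaybe (λ v → Maybe.map (λ p → word v p) (dec⇒maybe (zeros v ℕ.≟ 1))) vs)
           (f ∘ letters) ≈ ∑ vs f
    go []       = refl
    go (v ∷ vs) with zeros v ℕ.≟ 1
    ... | yes p = +-congˡ (go vs)
    ... | no ¬p = trans (go vs) (trans (sym (+-identityˡ _)) (+-congʳ (sym (f≈0 v ¬p))))

  ⊗-κ-support : (x : Word n) (v : Vec Letter n) → zeros v ≢ 1 → ⊗ κ (letters x) v ≈ 0#
  ⊗-κ-support x v z = ⊗-κ-zeros (letters x) v (λ eq → z (≡.trans eq (zeros≡1 x)))

  ∑-words-κ : (g : Matrix) (x : Word n) (z : Vec Letter n) →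
    ∑ (words n) (λ y → ⊗ κ (letters x) (letters y) *ᶠ ⊗ g (letters y) z) ≈
    ⊗ (κ ⋆ g) (letters x) z
  ∑-words-κ g x z = trans
    (∑-words (λ v → ⊗ κ (letters x) v *ᶠ ⊗ g v z) (λ v → zeroˡ′ ∘ ⊗-κ-support x v))
    (⊗-⋆ κ g (letters x) z)

  ⊗-κ-diagonal : (x : Vec Letter n) → ⊗ κ x x ≈ 1#
  ⊗-κ-diagonal []      = refl
  ⊗-κ-diagonal (a ∷ x) = trans (*-cong (κ-diagonal a) (⊗-κ-diagonal x)) (*-identityˡ 1#)

  ζ-word : (y z : Word n) → y ≼ z → ⊗ ζ (letters y) (letters z) ≈ 1#
  ζ-word y z y≼z =
    ⊗-ζ-≤ y≼z (ℕ.≤-reflexive (≡.trans (zeros≡1 y) (≡.sym (zeros≡1 z))))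

  -- On words `⊗ ζ` is the indicator of `≼`, which is the disjoint union of `≺` and equality.
  ≺+≡ : (y z : Word n) → 𝟙 (y ≺? z) +ᶠ ⊗ δ (letters y) (letters z) ≈ ⊗ ζ (letters y) (letters z)
  ≺+≡ y z = go (y ≼? z) (y ≟ z)
    where
    go : Dec (y ≼ z) → Dec (y ≡ z) →
         𝟙 (y ≺? z) +ᶠ ⊗ δ (letters y) (letters z) ≈ ⊗ ζ (letters y) (letters z)
    go _ (yes ≡.refl) = trans
      (+-cong (𝟙-false (y ≺? y) (λ y≺y → proj₂ y≺y ≡.refl)) (⊗-δ-refl (letters y)))
      (trans (+-identityˡ 1#) (sym (ζ-word y y (Pointwise.refl ℕ.≤-refl))))
    go (yes y≼z) (no y≢z) = trans
      (+-cong (𝟙-true (y ≺? z) (y≼z , y≢z))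
              (⊗-δ-≢ (letters y) (letters z) (y≢z ∘ letters-injective)))
      (trans (+-identityʳ 1#) (sym (ζ-word y z y≼z)))
    go (no y⋠z) (no y≢z) = trans
      (+-cong (𝟙-false (y ≺? z) (y⋠z ∘ proj₁))
              (⊗-δ-≢ (letters y) (letters z) (y≢z ∘ letters-injective)))
      (trans (+-identityʳ 0#) (sym (⊗-≰ ζ ζ-≰ (letters y) (letters z) y⋠z)))

  -- `⊗ κ` satisfies the recursion defining `μ`, because it inverts `⊗ ζ`. The accessibility proof
  -- is arbitrary so that the induction can follow its subproofs.
  μ-acc≈ : (x z : Word n) (rec : Acc _≺_ z) → μ-acc x z rec ≈ ⊗ κ (letters x) (letters z)
  μ-acc≈ {n} x z (acc rs) = go (x ≟ z)
    where
    X = letters x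
    Z = letters z

    term : ∀ y → μ-term x z rs y ≈ ⊗ κ X (letters y) *ᶠ 𝟙 (y ≺? z)
    term y with x ≼? y | y ≺? z
    ... | yes _  | yes y≺z = 
      trans (μ-acc≈ x y (rs y≺z)) (sym (trans (*-congˡ (𝟙-true (y ≺? z) y≺z)) (*-identityʳ _)))
    ... | yes _  | no y⊀z  = sym (zeroʳ′ (𝟙-false (y ≺? z) y⊀z))
    ... | no x⋠y | _       = sym (zeroˡ′ (⊗-≰ κ κ-≰ X (letters y) x⋠y))

    sum : x ≢ z → ⊗ κ X Z +ᶠ ∑ (words n) (μ-term x z rs) ≈ 0#
    sum x≢z = begin
      ⊗ κ X Z +ᶠ ∑ (words n) (μ-term x z rs)
        -- The entry at `Z` is spread out as a sum against `δ`, so that it merges with the sum over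
        -- `y ≺ z` into a sum against `ζ`.
        ≈⟨ +-cong (sym (trans (∑-words-κ δ x Z) (⊗-cong (⋆-δ κ) X Z)))
                  (∑-cong (words n) term) ⟩
      ∑ (words n) (λ y → ⊗ κ X (letters y) *ᶠ ⊗ δ (letters y) Z) +ᶠ
      ∑ (words n) (λ y → ⊗ κ X (letters y) *ᶠ 𝟙 (y ≺? z))
        ≈⟨ ∑-+ (words n) _ _ ⟩
      ∑ (words n) (λ y → ⊗ κ X (letters y) *ᶠ ⊗ δ (letters y) Z +ᶠ
                         ⊗ κ X (letters y) *ᶠ 𝟙 (y ≺? z))
        ≈⟨ ∑-cong (words n) (λ y → trans (sym (distribˡ _ _ _))
             (*-congˡ (trans (+-comm _ _) (≺+≡ y z)))) ⟩
      ∑ (words n) (λ y → ⊗ κ X (letters y) *ᶠ ⊗ ζ (letters y) Z)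
        ≈⟨ trans (∑-words-κ ζ x Z) (⊗-cong κ⋆ζ X Z) ⟩
      ⊗ δ X Z
        ≈⟨ ⊗-δ-≢ X Z (x≢z ∘ letters-injective) ⟩
      0# ∎

    go : (d : Dec (x ≡ z)) → (if does d then 1# else - ∑ (words n) (μ-term x z rs)) ≈ ⊗ κ X Z
    go (yes ≡.refl) = sym (⊗-κ-diagonal X)
    go (no x≢z)     = sym (+-inverseˡ-unique _ _ (sum x≢z))

  K-⊗ : (x w : Word n) → K x w ≈ ⊗ κ (letters x) (letters w)
  K-⊗ {n} x w = begin
    K x w
      ≈⟨ ∑-filter (x ≼?_) (words n) _ ⟩
    ∑ (words n) (λ x′ → 𝟙 (x ≼? x′) *ᶠ (μ x x′ *ᶠ ⟦ x′ ⟧ w))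
      ≈⟨ ∑-cong (words n) (λ x′ → trans (drop x′ (x ≼? x′)) (*-congˡ (⟦⟧-⊗ x′ w))) ⟩
    ∑ (words n) (λ x′ → ⊗ κ (letters x) (letters x′) *ᶠ ⊗ δ (letters x′) (letters w))
      ≈⟨ trans (∑-words-κ δ x (letters w)) (⊗-cong (⋆-δ κ) (letters x) (letters w)) ⟩
    ⊗ κ (letters x) (letters w) ∎
    where
    drop : ∀ x′ {r} (d : Dec (x ≼ x′)) →
           𝟙 d *ᶠ (μ x x′ *ᶠ r) ≈ ⊗ κ (letters x) (letters x′) *ᶠ r
    drop x′ (yes _)   = trans (*-identityˡ _) (*-congʳ (μ-acc≈ x x′ _))
    drop x′ (no x⋠x′) =
      trans (zeroˡ _) (sym (zeroˡ′ (⊗-≰ κ κ-≰ (letters x) (letters x′) x⋠x′)))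

  -- Maximum with a letter

  -- φ a b c is the coefficient of c in a ⊔ k, where k = b − (b + 1) (see κ).
  φ : Letter → Matrix
  φ a = κ ⋆ (λ b → δ (a ⊔ b))

  φ-zero : ∀ a c → φ a zero c ≈ δ a c
  φ-zero a c = trans
    (κ-⋆-zero (λ b → δ (a ⊔ b)) c)
    (reflexive (≡.cong (λ b → δ b c) (x≤y⇒y⊔x≈y {a} {zero} ℕ.z≤n)))

  -- Every letter occurring in the factor of `b` is at least `b`, hence fixed by the maximum with
  -- `a`.
  φ-≤ : ∀ {a b} c → a ≤ b → φ a b c ≈ κ b c
  φ-≤ {a} {b} c a≤b = trans (∑-cong (allFin (suc γ)) (λ b′ → absorb b′ (b ≤? b′))) (⋆-δ κ b c)
    where
    absorb : ∀ b′ → Dec (b ≤ b′) → κ b b′ *ᶠ δ (a ⊔ b′) c ≈ κ b b′ *ᶠ δ b′ c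
    absorb b′ (yes b≤b′) =
      reflexive (≡.cong (λ d → κ b b′ *ᶠ δ d c) (x≤y⇒x⊔y≈y (ℕ.≤-trans a≤b b≤b′)))
    absorb b′ (no b≰b′)  = trans (zeroˡ′ (κ-≰ b b′ b≰b′)) (sym (zeroˡ′ (κ-≰ b b′ b≰b′)))

  -- Both `b` and `b + 1` are at most `a`, so the maximum sends both to `a` and the difference
  -- cancels.
  φ-> : ∀ {a b} c → b ≢ zero → b < a → φ a b c ≈ 0#
  φ-> {b = zero}      c b≢0 b<a = contradiction ≡.refl b≢0
  φ-> {suc a} {suc b} c b≢0 b<a = trans (κ-⋆-suc (λ b → δ (suc a ⊔ b)) b c)
    (Δ-constant
      (λ b b≤a → reflexive (≡.cong (λ d → δ d c) (x≤y⇒y⊔x≈y {suc a} {suc b} (ℕ.s≤s b≤a))))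
      (ℕ.s≤s⁻¹ b<a))

  -- On a word, this keeps the factors of the nonzero letters and puts the combination `f` in place
  -- of the 0: `δ a` for the bare letter a, `κ a` for its factor.
  replaceZeroRow : (Letter → Carrier) → Matrix
  replaceZeroRow f zero    = f
  replaceZeroRow f (suc b) = κ (suc b)

  replaceZeroRow-noZero : (f g : Letter → Carrier) (y w : Vec Letter n) → zeros y ≡ 0 →
    ⊗ (replaceZeroRow f) y w ≈ ⊗ (replaceZeroRow g) y w
  replaceZeroRow-noZero f g []          []      z = refl
  replaceZeroRow-noZero f g (suc a ∷ y) (b ∷ w) z = *-congˡ (replaceZeroRow-noZero f g y w z)

  replaceZeroRow-cong : {f g : Letter → Carrier} → (∀ c → f c ≈ g c) → ∀ b c →
                        replaceZeroRow f b c ≈ replaceZeroRow g b c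
  replaceZeroRow-cong f≈g zero    = f≈g
  replaceZeroRow-cong f≈g (suc b) = λ c → refl

  -- With exactly one 0 in `y`, the product reads the replaced row once, hence is linear in it.
  replaceZeroRow-linear : (ks : List A) (r : A → Carrier) (f : A → Letter → Carrier)
    (y w : Vec Letter n) → zeros y ≡ 1 →
    ∑ ks (λ k → r k *ᶠ ⊗ (replaceZeroRow (f k)) y w) ≈
    ⊗ (replaceZeroRow (λ c → ∑ ks (λ k → r k *ᶠ f k c))) y w
  replaceZeroRow-linear ks r f (zero ∷ y) (c ∷ w) z = begin
    ∑ ks (λ k → r k *ᶠ (f k c *ᶠ ⊗ (replaceZeroRow (f k)) y w))
      -- No 0 is left in the tail, so its row can be changed to one that does not depend on `k`, and
      -- the tail factored out.
      ≈⟨ ∑-cong ks (λ k → trans (sym (*-assoc _ _ _))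
           (*-congˡ (replaceZeroRow-noZero (f k) _ y w (ℕ.suc-injective z)))) ⟩
    ∑ ks (λ k → (r k *ᶠ f k c) *ᶠ ⊗ (replaceZeroRow (λ c → ∑ ks (λ k → r k *ᶠ f k c))) y w)
      ≈⟨ ∑-*ʳ _ ks _ ⟩
    ∑ ks (λ k → r k *ᶠ f k c) *ᶠ ⊗ (replaceZeroRow (λ c → ∑ ks (λ k → r k *ᶠ f k c))) y w ∎
  replaceZeroRow-linear ks r f (suc b ∷ y) (c ∷ w) z = begin
    ∑ ks (λ k → r k *ᶠ (κ (suc b) c *ᶠ ⊗ (replaceZeroRow (f k)) y w))
      ≈⟨ ∑-cong ks (λ k → x∙yz≈y∙xz _ _ _) ⟩
    ∑ ks (λ k → κ (suc b) c *ᶠ (r k *ᶠ ⊗ (replaceZeroRow (f k)) y w))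
      ≈⟨ ∑-*ˡ _ ks _ ⟩
    κ (suc b) c *ᶠ ∑ ks (λ k → r k *ᶠ ⊗ (replaceZeroRow (f k)) y w)
      ≈⟨ *-congˡ (replaceZeroRow-linear ks r f y w z) ⟩
    κ (suc b) c *ᶠ ⊗ (replaceZeroRow (λ c → ∑ ks (λ k → r k *ᶠ f k c))) y w ∎

  infix 4 _≤⁺_
  _≤⁺_ : Letter → Vec Letter n → Set
  a ≤⁺ y = ∀ {b} → b ∈ y → b ≢ zero → a ≤ b

  ⊗-φ-≤ : ∀ {a} (y w : Vec Letter n) → a ≤⁺ y → ⊗ (φ a) y w ≈ ⊗ (replaceZeroRow (δ a)) y w
  ⊗-φ-≤ {a = a} y w a≤y = ⊗-cong-∈ y w λ
    { {zero}  _   c → φ-zero a c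
    ; {suc b} b∈y c → φ-≤ c (a≤y b∈y λ ())
    }

  ⊗-φ-> : ∀ {a b} {y : Vec Letter n} (w : Vec Letter n) → b ∈ y → b ≢ zero → b < a →
          ⊗ (φ a) y w ≈ 0#
  ⊗-φ-> w b∈y b≢0 b<a = ⊗-zero-∈ w b∈y (λ c → φ-> c b≢0 b<a)

  -- `h` covers both the plain composition and the one that replaces the 0. The bound on `a` makes
  -- it fix the nonzero letters of `y`.
  ⊗-κ-map : ∀ {a} (h : Letter → Letter) (y w : Vec Letter n) → a ≤⁺ y →
            (∀ b → h (suc b) ≡ a ⊔ suc b) →
            ⊗ κ (Vec.map h y) w ≈ ⊗ (replaceZeroRow (κ (h zero))) y w
  ⊗-κ-map h y w a≤y h-suc = trans (⊗-map κ h y w) (⊗-cong-∈ y w λ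
    { {zero}  _   c → refl
    ; {suc b} b∈y c → reflexive (≡.cong (λ d → κ d c)
        (≡.trans (h-suc b) (x≤y⇒x⊔y≈y (a≤y b∈y λ ()))))
    })

  -- The least nonzero letter

  nonzeros : Word n → List Letter
  nonzeros y = filter (λ b → ¬? (b Fin.≟ zero)) (Vec.toList (letters y))

  minLetter-≤ : (y : Word (2 + n)) → minLetter y ≤⁺ letters y
  minLetter-≤ y b∈y b≢0 =
    ListAll.lookup (Extrema.min≤xs (Fin.≤-totalOrder (suc γ)) (fromℕ γ) (nonzeros y))
      (ListMembership.∈-filter⁺ (λ b → ¬? (b Fin.≟ zero)) (VecMembership.∈-toList⁺ b∈y) b≢0)

  minLetter-∈ : (y : Word (2 + n)) {a : Letter} → minLetter y < a → minLetter y ∈ letters y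
  minLetter-∈ y {a} min<a
    with Extrema.argmin-sel (Fin.≤-totalOrder (suc γ)) (λ b → b) (fromℕ γ) (nonzeros y)
  -- The default value γ is excluded, as no letter exceeds it.
  ... | inj₁ min≡γ = contradiction (Fin.≤fromℕ a)
    (ℕ.<⇒≱ (≡.subst (_< a) min≡γ min<a))
  ... | inj₂ min∈y = VecMembership.∈-toList⁻
    (proj₁ (ListMembership.∈-filter⁻ (λ b → ¬? (b Fin.≟ zero)) {xs = Vec.toList (letters y)} min∈y))

  -- The contribution at the position of composition, in three cases

  module _ (y : Word (2 + n)) (w : Vec Letter (2 + n)) where

    private
      Y = letters y

    ⊗-φ-min< : ∀ {a} → minLetter y < a → ⊗ (φ a) Y w ≈ 0#
    ⊗-φ-min< min<a = ⊗-φ-> w (minLetter-∈ y min<a) (minLetter≢0 y) min<a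

    -- Row `a` of `κ` lives on `a` and `a + 1`, both at most `minLetter y`. Each such letter just
    -- takes the place of the 0 of `y`, and linearity rebuilds the factor of `a` there.
    block-< : ∀ a → a < minLetter y →
      ∑ (allFin (suc γ)) (λ a′ → κ a a′ *ᶠ ⊗ (φ a′) Y w) ≈ ⊗ κ (Vec.map (a ⊔_) Y) w
    block-< a a<min = begin
      ∑ (allFin (suc γ)) (λ a′ → κ a a′ *ᶠ ⊗ (φ a′) Y w)
        ≈⟨ ∑-cong (allFin (suc γ)) (λ a′ → term a′ (toℕ a′ ℕ.≤? suc (toℕ a))) ⟩
      ∑ (allFin (suc γ)) (λ a′ → κ a a′ *ᶠ ⊗ (replaceZeroRow (δ a′)) Y w)
        ≈⟨ replaceZeroRow-linear (allFin (suc γ)) (κ a) δ Y w (zeros≡1 y) ⟩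
      ⊗ (replaceZeroRow ((κ ⋆ δ) a)) Y w
        ≈⟨ ⊗-cong (replaceZeroRow-cong (⋆-δ κ a)) Y w ⟩
      ⊗ (replaceZeroRow (κ a)) Y w
        ≡⟨ ≡.cong (λ b → ⊗ (replaceZeroRow (κ b)) Y w) (x≤y⇒y⊔x≈y {a} {zero} ℕ.z≤n) ⟨
      ⊗ (replaceZeroRow (κ (a ⊔ zero))) Y w
        ≈⟨ ⊗-κ-map (a ⊔_) Y w
             (λ b∈y b≢0 → ℕ.≤-trans (ℕ.<⇒≤ a<min) (minLetter-≤ y b∈y b≢0)) (λ b → ≡.refl) ⟨
      ⊗ κ (Vec.map (a ⊔_) Y) w ∎
      where
      term : ∀ a′ → Dec (toℕ a′ ℕ.≤ suc (toℕ a)) →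
             κ a a′ *ᶠ ⊗ (φ a′) Y w ≈ κ a a′ *ᶠ ⊗ (replaceZeroRow (δ a′)) Y w
      term a′ (yes a′≤a+1) = *-congˡ (⊗-φ-≤ Y w
        (λ b∈y b≢0 → ℕ.≤-trans (ℕ.≤-trans a′≤a+1 a<min) (minLetter-≤ y b∈y b≢0)))
      term a′ (no a′≰a+1)  =
        trans (zeroˡ′ (κ-> a a′ a′≰a+1)) (sym (zeroˡ′ (κ-> a a′ a′≰a+1)))

    -- Here `a + 1` already exceeds the minimum and contributes nothing. The remaining bare letter
    -- `a` in place of the 0 telescopes into factors.
    block-≡ : ∀ a → minLetter y ≡ a →
      ∑ (allFin (suc γ)) (λ a′ → κ a a′ *ᶠ ⊗ (φ a′) Y w) ≈
      ∑ (filter (λ b → a ≤? suc b) (allFin γ))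
        (λ b → ⊗ κ (Vec.map (replacing0 (suc b) (a ⊔_)) Y) w)
    block-≡ a min≡a = begin
      ∑ (allFin (suc γ)) (λ a′ → κ a a′ *ᶠ ⊗ (φ a′) Y w)
        ≈⟨ ∑-cong (allFin (suc γ)) term ⟩
      ∑ (allFin (suc γ)) (λ a′ → ⊗ (φ a′) Y w *ᶠ δ a′ a)
        ≈⟨ ∑-δ (λ a′ → ⊗ (φ a′) Y w) a ⟩
      ⊗ (φ a) Y w
        ≈⟨ ⊗-φ-≤ Y w a≤y ⟩
      ⊗ (replaceZeroRow (δ a)) Y w
        ≈⟨ ⊗-cong (replaceZeroRow-cong
             (λ c → ∑-κ-≥ a c (minLetter≡⇒≢0 y min≡a))) Y w ⟨
      ⊗ (replaceZeroRow (λ c → ∑ (allFin γ) (λ b → 𝟙 (a ≤? suc b) *ᶠ κ (suc b) c))) Y w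
        ≈⟨ replaceZeroRow-linear (allFin γ) _ (κ ∘ suc) Y w (zeros≡1 y) ⟨
      ∑ (allFin γ) (λ b → 𝟙 (a ≤? suc b) *ᶠ ⊗ (replaceZeroRow (κ (suc b))) Y w)
        ≈⟨ ∑-cong (allFin γ) (λ b → *-congˡ
             (⊗-κ-map (replacing0 (suc b) (a ⊔_)) Y w a≤y (λ _ → ≡.refl))) ⟨
      ∑ (allFin γ) (λ b → 𝟙 (a ≤? suc b) *ᶠ ⊗ κ (Vec.map (replacing0 (suc b) (a ⊔_)) Y) w)
        ≈⟨ ∑-filter (λ b → a ≤? suc b) (allFin γ) _ ⟨
      ∑ (filter (λ b → a ≤? suc b) (allFin γ))
        (λ b → ⊗ κ (Vec.map (replacing0 (suc b) (a ⊔_)) Y) w) ∎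
      where
      a≤y : a ≤⁺ Y
      a≤y = ≡.subst (_≤⁺ Y) min≡a (minLetter-≤ y)

      -- Off the diagonal both sides vanish: for smaller `a′` by triangularity of `κ`, for larger
      -- `a′` because it exceeds the minimum of `y`.
      term : ∀ a′ → κ a a′ *ᶠ ⊗ (φ a′) Y w ≈ ⊗ (φ a′) Y w *ᶠ δ a′ a
      term a′ with Fin.<-cmp a′ a
      ... | tri< a′<a a′≢a _ =
        trans (zeroˡ′ (κ-≰ a a′ (ℕ.<⇒≱ a′<a))) (sym (zeroʳ′ (𝟙-false (a′ Fin.≟ a) a′≢a)))
      ... | tri≈ _ ≡.refl _  = trans (*-comm _ _)
        (*-congˡ (trans (κ-diagonal a) (sym (𝟙-true (a Fin.≟ a) ≡.refl))))
      ... | tri> _ a′≢a a<a′ = trans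
        (zeroʳ′ (⊗-φ-min< (≡.subst (_< a′) (≡.sym min≡a) a<a′)))
        (sym (zeroʳ′ (𝟙-false (a′ Fin.≟ a) a′≢a)))

    block-> : ∀ a → minLetter y < a →
      ∑ (allFin (suc γ)) (λ a′ → κ a a′ *ᶠ ⊗ (φ a′) Y w) ≈ 0#
    block-> a min<a = ∑-zero (allFin (suc γ)) (λ a′ → term a′ (a ≤? a′))
      where
      term : ∀ a′ → Dec (a ≤ a′) → κ a a′ *ᶠ ⊗ (φ a′) Y w ≈ 0#
      term a′ (yes a≤a′) = zeroʳ′ (⊗-φ-min< (ℕ.<-≤-trans min<a a≤a′))
      term a′ (no a≰a′)  = zeroˡ′ (κ-≰ a a′ a≰a′)

  -- Composition

  -- The letters of `u ∘[ i ] v`, for arbitrary vectors, since the sums range over all of them.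
  composite : Vec Letter (suc n) → Fin (suc n) → Vec Letter m → Vec Letter (n + m)
  composite u i v = insert u i (Vec.map (lookup u i ⊔_) v)

  -- Away from position `i` the letters of `u` are copied, so their factors split off and only
  -- `block` is left. Leaving `ks` and `z` abstract treats the three cases at once.
  ∑-vectors-∘ : (ks : List A) (z : A → Vec Letter m)
    (x : Vec Letter (suc n)) (i : Fin (suc n)) (y : Vec Letter m) →
    (∀ w → ∑ (allFin (suc γ)) (λ a → κ (lookup x i) a *ᶠ ⊗ (φ a) y w) ≈
           ∑ ks (λ k → ⊗ κ (z k) w)) →
    ∀ w → ∑ (vectors (suc n)) (λ u → ∑ (vectors m) (λ v →
            (⊗ κ x u *ᶠ ⊗ κ y v) *ᶠ ⊗ δ (composite u i v) w)) ≈
          ∑ ks (λ k → ⊗ κ (insert x i (z k)) w)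
  ∑-vectors-∘ {m = m} {n = n} ks z (a₀ ∷ x) zero y block w
    -- `w₁` receives the letters coming from `y` and `w₂` those of the rest of `x`.
    with splitAt m (cast (ℕ.+-comm n m) w)
  ... | w₁ , w₂ , eq with Vec.cast-sym (ℕ.+-comm n m) eq
  ... | ≡.refl = begin
    ∑ (vectors (suc n)) (λ u → ∑ (vectors m) (λ v →
      (⊗ κ (a₀ ∷ x) u *ᶠ ⊗ κ y v) *ᶠ ⊗ δ (composite u zero v) W))
      ≈⟨ ∑-vectors (λ u → ∑ (vectors m) (λ v →
           (⊗ κ (a₀ ∷ x) u *ᶠ ⊗ κ y v) *ᶠ ⊗ δ (composite u zero v) W)) ⟩
    ∑ (allFin (suc γ)) (λ a → ∑ (vectors n) (λ u → ∑ (vectors m) (λ v →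
      ((κ a₀ a *ᶠ ⊗ κ x u) *ᶠ ⊗ κ y v) *ᶠ ⊗ δ (composite (a ∷ u) zero v) W)))
      ≈⟨ ∑-cong (allFin (suc γ)) (λ a → ∑-cong (vectors n) (λ u → ∑-cong (vectors m) (λ v →
           trans (*-congˡ (split-δ (Vec.map (a ⊔_) v) u)) (rearrange _ _ _ _ _)))) ⟩
    ∑ (allFin (suc γ)) (λ a → ∑ (vectors n) (λ u → ∑ (vectors m) (λ v →
      (⊗ κ x u *ᶠ ⊗ δ u w₂) *ᶠ (κ a₀ a *ᶠ (⊗ κ y v *ᶠ ⊗ δ (Vec.map (a ⊔_) v) w₁)))))
      ≈⟨ ∑-cong (allFin (suc γ)) (λ a → ∑-× (vectors n) (vectors m) _ _) ⟩
    ∑ (allFin (suc γ)) (λ a → ∑ (vectors n) (λ u → ⊗ κ x u *ᶠ ⊗ δ u w₂) *ᶠ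
      ∑ (vectors m) (λ v → κ a₀ a *ᶠ (⊗ κ y v *ᶠ ⊗ δ (Vec.map (a ⊔_) v) w₁)))
      ≈⟨ ∑-*ˡ _ (allFin (suc γ)) _ ⟩
    ∑ (vectors n) (λ u → ⊗ κ x u *ᶠ ⊗ δ u w₂) *ᶠ
    ∑ (allFin (suc γ)) (λ a →
      ∑ (vectors m) (λ v → κ a₀ a *ᶠ (⊗ κ y v *ᶠ ⊗ δ (Vec.map (a ⊔_) v) w₁)))
      ≈⟨ *-cong (trans (⊗-⋆ κ δ x w₂) (⊗-cong (⋆-δ κ) x w₂))
           (∑-cong (allFin (suc γ)) (λ a → trans (∑-*ˡ _ (vectors m) _) (*-congˡ (push a)))) ⟩
    ⊗ κ x w₂ *ᶠ ∑ (allFin (suc γ)) (λ a → κ a₀ a *ᶠ ⊗ (φ a) y w₁)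
      ≈⟨ *-congˡ (block w₁) ⟩
    ⊗ κ x w₂ *ᶠ ∑ ks (λ k → ⊗ κ (z k) w₁)
      ≈⟨ ∑-*ˡ _ ks _ ⟨
    ∑ ks (λ k → ⊗ κ x w₂ *ᶠ ⊗ κ (z k) w₁)
      ≈⟨ ∑-cong ks (λ k → trans
           (trans (⊗-cast κ (ℕ.+-comm m n) _ _) (⊗-++ κ (z k) w₁ x w₂)) (*-comm _ _)) ⟨
    ∑ ks (λ k → ⊗ κ (insert (a₀ ∷ x) zero (z k)) W) ∎
    where
    W = cast (ℕ.+-comm m n) (w₁ Vec.++ w₂)

    split-δ : ∀ v u → ⊗ δ (cast (ℕ.+-comm m n) (v Vec.++ u)) W ≈ ⊗ δ v w₁ *ᶠ ⊗ δ u w₂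
    split-δ v u = trans (⊗-cast δ (ℕ.+-comm m n) _ _) (⊗-++ δ v w₁ u w₂)

    rearrange : ∀ p q r s t → ((p *ᶠ q) *ᶠ r) *ᶠ (s *ᶠ t) ≈ (q *ᶠ t) *ᶠ (p *ᶠ (r *ᶠ s))
    rearrange = solve 5
      (λ p q r s t → ((p ⊕ q) ⊕ r) ⊕ (s ⊕ t) ⊜ (q ⊕ t) ⊕ (p ⊕ (r ⊕ s))) refl

    -- Taking the maximum with `a` letterwise is the Kronecker power of the matrix with rows
    -- `δ (a ⊔ b)`.
    push : ∀ a → ∑ (vectors m) (λ v → ⊗ κ y v *ᶠ ⊗ δ (Vec.map (a ⊔_) v) w₁) ≈ ⊗ (φ a) y w₁
    push a = trans
      (∑-cong (vectors m) (λ v → *-congˡ (⊗-map δ (a ⊔_) v w₁)))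
      (⊗-⋆ κ (λ b → δ (a ⊔ b)) y w₁)
  ∑-vectors-∘ {m = m} {n = suc n} ks z (a₀ ∷ x) (suc i) y block (b ∷ w) = begin
    ∑ (vectors (2 + n)) (λ u → ∑ (vectors m) (λ v →
      (⊗ κ (a₀ ∷ x) u *ᶠ ⊗ κ y v) *ᶠ ⊗ δ (composite u (suc i) v) (b ∷ w)))
      ≈⟨ ∑-vectors (λ u → ∑ (vectors m) (λ v →
           (⊗ κ (a₀ ∷ x) u *ᶠ ⊗ κ y v) *ᶠ ⊗ δ (composite u (suc i) v) (b ∷ w))) ⟩
    ∑ (allFin (suc γ)) (λ a → ∑ (vectors (suc n)) (λ u → ∑ (vectors m) (λ v →
      ((κ a₀ a *ᶠ ⊗ κ x u) *ᶠ ⊗ κ y v) *ᶠ (δ a b *ᶠ ⊗ δ (composite u i v) w))))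
      -- The first letter is only compared with `b`, so its factor leaves the sums over `u` and `v`.
      ≈⟨ ∑-cong (allFin (suc γ)) (λ a → trans
           (∑-cong (vectors (suc n)) (λ u → trans
             (∑-cong (vectors m) (λ v → rearrange _ _ _ _ _))
             (∑-*ˡ _ (vectors m) _)))
           (∑-*ˡ _ (vectors (suc n)) _)) ⟩
    ∑ (allFin (suc γ)) (λ a → (κ a₀ a *ᶠ δ a b) *ᶠ
      ∑ (vectors (suc n)) (λ u → ∑ (vectors m) (λ v →
        (⊗ κ x u *ᶠ ⊗ κ y v) *ᶠ ⊗ δ (composite u i v) w)))
      ≈⟨ ∑-*ʳ _ (allFin (suc γ)) _ ⟩
    (κ ⋆ δ) a₀ b *ᶠ
      ∑ (vectors (suc n)) (λ u → ∑ (vectors m) (λ v →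
        (⊗ κ x u *ᶠ ⊗ κ y v) *ᶠ ⊗ δ (composite u i v) w))
      ≈⟨ *-cong (⋆-δ κ a₀ b) (∑-vectors-∘ ks z x i y block w) ⟩
    κ a₀ b *ᶠ ∑ ks (λ k → ⊗ κ (insert x i (z k)) w)
      ≈⟨ ∑-*ˡ _ ks _ ⟨
    ∑ ks (λ k → ⊗ κ (insert (a₀ ∷ x) (suc i) (z k)) (b ∷ w)) ∎
    where
    rearrange : ∀ p q r s t → ((p *ᶠ q) *ᶠ r) *ᶠ (s *ᶠ t) ≈ (p *ᶠ s) *ᶠ ((q *ᶠ r) *ᶠ t)
    rearrange = solve 5
      (λ p q r s t → ((p ⊕ q) ⊕ r) ⊕ (s ⊕ t) ⊜ (p ⊕ s) ⊕ ((q ⊕ r) ⊕ t)) refl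

  -- The coordinates given by `⊗ κ` vanish on vectors that are not words, so both sums extend to all
  -- vectors.
  K-∘ : (ks : List A) (z : A → Vec Letter m) (x : Word (suc n)) (i : Fin (suc n)) (y : Word m) →
    (∀ w → ∑ (allFin (suc γ)) (λ a → κ (lookup (letters x) i) a *ᶠ ⊗ (φ a) (letters y) w) ≈
           ∑ ks (λ k → ⊗ κ (z k) w)) →
    ∀ w → (K x ∘ᵥ[ i ] K y) w ≈ ∑ ks (λ k → ⊗ κ (insert (letters x) i (z k)) (letters w))
  K-∘ {m = m} {n = n} ks z x i y block w = begin
    (K x ∘ᵥ[ i ] K y) w
      ≈⟨ ∑-cong (words (suc n)) (λ u → ∑-cong (words m) (λ v →
           *-cong (*-cong (K-⊗ x u) (K-⊗ y v)) (⟦⟧-⊗ (u ∘[ i ] v) w))) ⟩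
    ∑ (words (suc n)) (λ u → ∑ (words m) (λ v → term (letters u) (letters v)))
      ≈⟨ ∑-cong (words (suc n)) (λ u → ∑-words (term (letters u))
           (λ v → zeroˡ′ ∘ zeroʳ′ ∘ ⊗-κ-support y v)) ⟩
    ∑ (words (suc n)) (λ u → ∑ (vectors m) (term (letters u)))
      ≈⟨ ∑-words (λ u → ∑ (vectors m) (term u))
           (λ u zu → ∑-zero (vectors m) (λ v → zeroˡ′ (zeroˡ′ (⊗-κ-support x u zu)))) ⟩
    ∑ (vectors (suc n)) (λ u → ∑ (vectors m) (term u))
      ≈⟨ ∑-vectors-∘ ks z (letters x) i (letters y) block (letters w) ⟩
    ∑ ks (λ k → ⊗ κ (insert (letters x) i (z k)) (letters w)) ∎
    where
    term : Vec Letter (suc n) → Vec Letter m → Carrier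
    term u v =
      (⊗ κ (letters x) u *ᶠ ⊗ κ (letters y) v) *ᶠ ⊗ δ (composite u i v) (letters w)

theorem2p3p7 : ∀ {c ℓ₁ ℓ₂} (F : HeytingField c ℓ₁ ℓ₂) → CharacteristicZero F →
    (γ : ℕ) → let open Dias F γ in
    (n m : ℕ) (x : Word (2 + n)) (y : Word (2 + m)) (i : Fin (2 + n)) →
    let xᵢ = lookup (letters x) i in
    (xᵢ < minLetter y → K x ∘ᵥ[ i ] K y ≋ K (x ∘[ i ] y)) ×
    ((min≡xᵢ : minLetter y ≡ xᵢ) →
    K x ∘ᵥ[ i ] K y ≋
    ∑ᵥ (filter (λ a → xᵢ ≤? suc a) (allFin γ))
    (λ a → K (x ∘[ a , i ∣ minLetter≡⇒≢0 y min≡xᵢ ] y))) ×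
    (minLetter y < xᵢ → K x ∘ᵥ[ i ] K y ≋ 0ᵥ)
theorem2p3p7 F _ γ n m x y i = below , equal , above
  where
  open Dias F γ
  open KBasis F γ
  open CommutativeRing
    (HeytingCommutativeRing.commutativeRing (HeytingField.heytingCommutativeRing F))
    using (trans; sym; +-identityʳ)

  xᵢ = lookup (letters x) i

  below : xᵢ < minLetter y → K x ∘ᵥ[ i ] K y ≋ K (x ∘[ i ] y)
  below xᵢ<min w = trans
    -- Any one-element list of indices gives the required one-term sum.
    (K-∘ (x ∷ []) (λ _ → Vec.map (xᵢ ⊔_) (letters y)) x i y
      (λ w₁ → trans (block-< y w₁ xᵢ xᵢ<min) (sym (+-identityʳ _))) w)
    (trans (+-identityʳ _) (sym (K-⊗ (x ∘[ i ] y) w)))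

  equal : (min≡xᵢ : minLetter y ≡ xᵢ) → K x ∘ᵥ[ i ] K y ≋
    ∑ᵥ (filter (λ a → xᵢ ≤? suc a) (allFin γ))
       (λ a → K (x ∘[ a , i ∣ minLetter≡⇒≢0 y min≡xᵢ ] y))
  equal min≡xᵢ w = trans
    (K-∘ (filter (λ a → xᵢ ≤? suc a) (allFin γ))
      (λ a → Vec.map (replacing0 (suc a) (xᵢ ⊔_)) (letters y)) x i y
      (λ w₁ → block-≡ y w₁ xᵢ min≡xᵢ) w)
    (∑-cong (filter (λ a → xᵢ ≤? suc a) (allFin γ))
      (λ a → sym (K-⊗ (x ∘[ a , i ∣ minLetter≡⇒≢0 y min≡xᵢ ] y) w)))

  above : minLetter y < xᵢ → K x ∘ᵥ[ i ] K y ≋ 0ᵥ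
  -- The empty list of indices gives the empty sum, which is `0#`.
  above min<xᵢ = K-∘ [] (λ a → a) x i y (λ w₁ → block-> y w₁ xᵢ min<xᵢ)
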